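{- The (finite) Hilbert calculus $\mathcal{CR}$ axiomatizes the logic $\mathcal{L}_{\mathsf{CR}}$; that is, for every set of formulas $\Gamma\cup\{\varphi\}\subseteq Fm$ in the language of commutative rings, $\Gamma\vdash_{\mathcal{CR}}\varphi$ if and only if $\Gamma\vdash_{\mathcal{L}_{\mathsf{CR}}}\varphi$.
   Context: The language of commutative rings is $\langle +,\cdot,-,0,1\rangle$ of type $\langle 2,2,1,0,0\rangle$ ($-$ is unary). $\mathsf{CR}$ is the variety of commutative rings (with unity) in this language: $\langle A,+,-,0\rangle$ is an Abelian group, $\langle A,\cdot,1\rangle$ is a commutative monoid, and $a\cdot(b+c)=(a\cdot b)+(a\cdot c)$. $Fm$ is the set of formulas (terms) of this language over a countably infinite set of variables, and $\boldsymbol{Fm}$ the absolutely free algebra of formulas; substitutions are endomorphisms of $\boldsymbol{Fm}$. $\mathcal{L}_{\mathsf{CR}}$ is the logic determined by all matrices $\langle\boldsymbol{A},F\rangle$ with $\boldsymbol{A}\in\mathsf{CR}$ and $F\subseteq A$ an arbitrary subset: $\Gamma\vdash_{\mathcal{L}_{\mathsf{CR}}}\varphi$ iff for every $\boldsymbol{A}\in\mathsf{CR}$, every $F\subseteq A$ and every homomorphism $h\colon\boldsymbol{Fm}\to\boldsymbol{A}$, $h[\Gamma]\subseteq F$ implies $h(\varphi)\in F$. For a Hilbert calculus (a set of rules $\Gamma\vdash\varphi$ with $\Gamma\cup\{\varphi\}$ finite), the logic it determines is: $\Gamma\vdash\varphi$ iff there is a finite proof of $\varphi$ from $\Gamma$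 using substitution instances of the rules. The expression $\alpha\dashv\vdash\beta$ abbreviates the two rules $\alpha\vdash\beta$ and $\beta\vdash\alpha$. $\mathcal{CR}$ is the following Hilbert calculus (and also the logic it determines), where $x,y,z,u,w$ are distinct variables: (A) $w+(u\cdot((x\cdot y)\cdot z))\dashv\vdash w+(u\cdot(x\cdot(y\cdot z)))$ (B) $w+(u\cdot(x\cdot y))\dashv\vdash w+(u\cdot(y\cdot x))$ (C) $w+(u\cdot(x\cdot 1))\dashv\vdash w+(u\cdot x)$ (D) $w+(u\cdot((x+y)+z))\dashv\vdash w+(u\cdot(x+(y+z)))$ (E) $w+(u\cdot(x+y))\dashv\vdash w+(u\cdot(y+x))$ (F) $w+(u\cdot(x+0))\dashv\vdash w+(u\cdot x)$ (G) $w+(u\cdot(x+(-x)))\dashv\vdash w+(u\cdot 0)$ (H) $w+(u\cdot(x\cdot(y+z)))\dashv\vdash w+(u\cdot((x\cdot y)+(x\cdot z)))$ (I) $w+(u\cdot(-(x+y)))\dashv\vdash w+(u\cdot((-x)+(-y)))$ (L) $w+(u\cdot(-(x\cdot y)))\dashv\vdash w+(u\cdot((-x)\cdot y))$ (M) $w+(u\cdot(-(x\cdot y)))\dashv\vdash w+(u\cdot(x\cdot(-y)))$ (N) $0+x\dashv\vdash x$ (O) $x+(1\cdot y)\dashv\vdash x+y$ -}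

module Defs where

open import Algebra.Bundles using (CommutativeRing)
open import Algebra.Bundles.Raw using (RawRing)
open import Algebra.Morphism.Structures using (module RingMorphisms)
open import Data.List.Base using (List; []; _∷_; [_]; concat)
open import Data.List.Membership.Propositional using () renaming (_∈_ to _∈ˡ_)
open import Data.List.Relation.Unary.All using (All)
open import Data.Nat.Base using (ℕ)
open import Data.Product.Base using (Σ-syntax)
open import Level using (Level; 0ℓ; suc; _⊔_)
open import Relation.Binary.PropositionalEquality.Core using (_≡_)
open import Relation.Unary using (Pred; _∈_)

private variable
  a ℓ : Level

infixl 6 _+_
infixl 7 _·_
infix  8 -_

data Fm : Set where
  var : ℕ → Fm
  _+_ : Fm → Fm → Fm
  _·_ : Fm → Fm → Fm
  -_  : Fm → Fm
  0#  : Fm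
  1#  : Fm

-- The absolutely free algebra on ℕ: terms are equal only when syntactically so.
𝑭𝒎 : RawRing 0ℓ 0ℓ
𝑭𝒎 = record
  { Carrier = Fm
  ; _≈_     = _≡_
  ; _+_     = _+_
  ; _*_     = _·_
  ; -_      = -_
  ; 0#      = 0#
  ; 1#      = 1#
  }

IsSubstitution : (Fm → Fm) → Set
IsSubstitution = RingMorphisms.IsRingHomomorphism 𝑭𝒎 𝑭𝒎

infix 3 _▷_

record Rule : Set where
  constructor _▷_
  field
    premises   : List Fm
    conclusion : Fm

-- A proof is a finite sequence of formulas, listed with the latest one first.
data IsProof (H : Pred Rule a) (Γ : Pred Fm ℓ) : List Fm → Set (a ⊔ ℓ) where
  []     : IsProof H Γ []
  by-hyp : ∀ {p φ} → IsProof H Γ p → φ ∈ Γ → IsProof H Γ (φ ∷ p)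
  by-rule : ∀ {p Δ ψ} → IsProof H Γ p →
            (Δ ▷ ψ) ∈ H →
            (σ : Fm → Fm) → IsSubstitution σ →
            All (λ δ → σ δ ∈ˡ p) Δ →
            IsProof H Γ (σ ψ ∷ p)

infix 2 _⊢[_]_

_⊢[_]_ : Pred Fm ℓ → Pred Rule a → Fm → Set (a ⊔ ℓ)
Γ ⊢[ H ] φ = Σ[ p ∈ List Fm ] IsProof H Γ (φ ∷ p)

infix 3 _⊣⊢_

_⊣⊢_ : Fm → Fm → List Rule
α ⊣⊢ β = ([ α ] ▷ β) ∷ ([ β ] ▷ α) ∷ []

𝒞ℛ-rules : List Rule
𝒞ℛ-rules = concat
  ( (w + (u · ((x · y) · z)) ⊣⊢ w + (u · (x · (y · z))))
  ∷ (w + (u · (x · y))       ⊣⊢ w + (u · (y · x)))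
  ∷ (w + (u · (x · 1#))      ⊣⊢ w + (u · x))
  ∷ (w + (u · ((x + y) + z)) ⊣⊢ w + (u · (x + (y + z))))
  ∷ (w + (u · (x + y))       ⊣⊢ w + (u · (y + x)))
  ∷ (w + (u · (x + 0#))      ⊣⊢ w + (u · x))
  ∷ (w + (u · (x + (- x)))   ⊣⊢ w + (u · 0#))
  ∷ (w + (u · (x · (y + z))) ⊣⊢ w + (u · ((x · y) + (x · z))))
  ∷ (w + (u · (- (x + y)))   ⊣⊢ w + (u · ((- x) + (- y))))
  ∷ (w + (u · (- (x · y)))   ⊣⊢ w + (u · ((- x) · y)))
  ∷ (w + (u · (- (x · y)))   ⊣⊢ w + (u · (x · (- y))))
  ∷ (0# + x                  ⊣⊢ x)
  ∷ (x + (1# · y)            ⊣⊢ x + y)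
  ∷ [])
  where
  x y z u w : Fm
  x = var 0
  y = var 1
  z = var 2
  u = var 3
  w = var 4

infix 2 _⊢𝒞ℛ_

_⊢𝒞ℛ_ : Pred Fm ℓ → Fm → Set ℓ
Γ ⊢𝒞ℛ φ = Γ ⊢[ _∈ˡ 𝒞ℛ-rules ] φ

infix 2 _⊢𝓛[_,_]_

-- Rings come with a setoid equality _≈_, so a subset of a ring is a predicate
-- respecting _≈_.  The levels c and r of the rings are arbitrary, while the
-- subsets F live at the same level as Γ.
_⊢𝓛[_,_]_ : Pred Fm ℓ → (c r : Level) → Fm → Set (suc (c ⊔ r ⊔ ℓ))
_⊢𝓛[_,_]_ {ℓ} Γ c r φ =
  (𝑨 : CommutativeRing c r) → let open CommutativeRing 𝑨 using (Carrier; _≈_; rawRing) in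
  (F : Pred Carrier ℓ) → (∀ {a b} → a ≈ b → a ∈ F → b ∈ F) →
  (h : Fm → Carrier) → RingMorphisms.IsRingHomomorphism 𝑭𝒎 rawRing h →
  (∀ {γ} → γ ∈ Γ → h γ ∈ F) → h φ ∈ F

{-# OPTIONS --safe #-}
-- Every rule of 𝒞ℛ has one premise, so derivability from Γ is closure of Γ under
-- the equivalence generated by the instances of the rules, and soundness amounts
-- to both sides of every rule denoting the same element of every commutative ring.
-- For completeness, call s and t congruent when w + u · s and w + u · t are
-- equivalent for all w and u.  Since s is equivalent to 0 + 1 · s by (N) and (O),
-- congruent formulas are equivalent.  Congruence is compatible with the operations,
-- and (A)–(M) say that the formulas modulo congruence form a commutative ring;
-- there, take for F the set of the formulas derivable from Γ.
module Submission where

open import Defs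
open import Algebra.Bundles using (CommutativeRing)
open import Algebra.Bundles.Raw using (RawRing)
open import Algebra.Consequences.Setoid using (comm∧idʳ⇒id; comm∧invʳ⇒inv; comm∧distrˡ⇒distr)
open import Algebra.Morphism.Construct.Composition using (isRingHomomorphism)
import Algebra.Morphism.RingMonomorphism as RingMonomorphism
open import Algebra.Morphism.Structures using (module RingMorphisms)
import Algebra.Properties.Ring as RingProperties
open import Algebra.Structures using (IsCommutativeRing)
open import Data.Fin.Base using (Fin)
open import Data.Fin.Patterns
open import Data.List.Base using (List; []; _∷_; _++_; [_]; length; lookup; map)
open import Data.List.Membership.Propositional using () renaming (_∈_ to _∈ˡ_)
open import Data.List.Membership.Propositional.Properties
  using (∈-concatMap⁺; ∈-lookup; ∈-map⁺; ∈-++⁺ˡ; ∈-++⁺ʳ)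
open import Data.List.Relation.Unary.All as All using (All; []; _∷_)
import Data.List.Relation.Unary.All.Properties as All
open import Data.List.Relation.Unary.Any as Any using (here; there)
open import Data.Nat.Base using (ℕ)
open import Data.Product.Base using (_×_; _,_; proj₁; proj₂; uncurry)
open import Function.Base using (_∘_)
open import Function.Bundles using (_⇔_; mk⇔; Equivalence)
open import Function.Properties.Equivalence using (⇔-isEquivalence)
open import Level using (Level; 0ℓ; Lift; lift; lower)
open import Relation.Binary.Bundles using (Setoid)
import Relation.Binary.Construct.Closure.Equivalence as EqClosure
import Relation.Binary.Construct.On as On
open import Relation.Binary.PropositionalEquality.Core using (refl; cong)
import Relation.Binary.Reasoning.Setoid as SetoidReasoning
open import Relation.Unary using (Pred; _∈_)

private variable
  ℓ c r : Level

-- The calculus as a list of equations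

identities : List (Fm × Fm)
identities
  = ((x · y) · z , x · (y · z))
  ∷ (x · y       , y · x)
  ∷ (x · 1#      , x)
  ∷ ((x + y) + z , x + (y + z))
  ∷ (x + y       , y + x)
  ∷ (x + 0#      , x)
  ∷ (x + (- x)   , 0#)
  ∷ (x · (y + z) , (x · y) + (x · z))
  ∷ (- (x + y)   , (- x) + (- y))
  ∷ (- (x · y)   , (- x) · y)
  ∷ (- (x · y)   , x · (- y))
  ∷ []
  where
  x y z : Fm
  x = var 0
  y = var 1
  z = var 2

-- Variables 3 and 4 are the `u` and `w` of the calculus; `identities` mentions only 0, 1 and 2.
inContext : Fm × Fm → Fm × Fm
inContext (s , t) = var 4 + (var 3 · s) , var 4 + (var 3 · t)

unitLaws : List (Fm × Fm)
unitLaws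
  = (0# + var 0            , var 0)
  ∷ (var 0 + (1# · var 1)  , var 0 + var 1)
  ∷ []

-- Order and variable numbers follow the calculus, so `𝒞ℛ-rules` is by computation the concatenation
-- of the lists `uncurry _⊣⊢_ e` over the entries `e`.
axioms : List (Fm × Fm)
axioms = map inContext identities ++ unitLaws

-- Validity of the equations in commutative rings

module Evaluation (𝑹 : RawRing c r) where
  private module 𝑹 = RawRing 𝑹

  ⟦_⟧ : Fm → (ℕ → 𝑹.Carrier) → 𝑹.Carrier
  ⟦ var n ⟧ ρ = ρ n
  ⟦ s + t ⟧ ρ = ⟦ s ⟧ ρ 𝑹.+ ⟦ t ⟧ ρ
  ⟦ s · t ⟧ ρ = ⟦ s ⟧ ρ 𝑹.* ⟦ t ⟧ ρ
  ⟦ - s   ⟧ ρ = 𝑹.- ⟦ s ⟧ ρ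
  ⟦ 0#    ⟧ ρ = 𝑹.0#
  ⟦ 1#    ⟧ ρ = 𝑹.1#

module _ (𝑨 : CommutativeRing c r) where
  private module 𝑨 = CommutativeRing 𝑨
  open Evaluation 𝑨.rawRing
  open RingProperties 𝑨.ring using (-‿+-comm; -‿distribˡ-*; -‿distribʳ-*)

  Holds : Fm × Fm → Set _
  Holds (s , t) = ∀ ρ → ⟦ s ⟧ ρ 𝑨.≈ ⟦ t ⟧ ρ

  identities-hold : All Holds identities
  identities-hold
    = (λ _ → 𝑨.*-assoc _ _ _)
    ∷ (λ _ → 𝑨.*-comm _ _)
    ∷ (λ _ → 𝑨.*-identityʳ _)
    ∷ (λ _ → 𝑨.+-assoc _ _ _)
    ∷ (λ _ → 𝑨.+-comm _ _)
    ∷ (λ _ → 𝑨.+-identityʳ _)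
    ∷ (λ _ → 𝑨.-‿inverseʳ _)
    ∷ (λ _ → 𝑨.distribˡ _ _ _)
    ∷ (λ _ → 𝑨.sym (-‿+-comm _ _))
    ∷ (λ _ → -‿distribˡ-* _ _)
    ∷ (λ _ → -‿distribʳ-* _ _)
    ∷ []

  axioms-hold : All Holds axioms
  axioms-hold = All.++⁺ (All.map⁺ {f = inContext} (All.map (λ {e} → inContext-holds e) identities-hold))
    ( (λ _ → 𝑨.+-identityˡ _)
    ∷ (λ _ → 𝑨.+-congˡ (𝑨.*-identityˡ _))
    ∷ [])
    where
    inContext-holds : ∀ e → Holds e → Holds (inContext e)
    inContext-holds _ s≈t ρ = 𝑨.+-congˡ (𝑨.*-congˡ (s≈t ρ))

  module _ {h : Fm → 𝑨.Carrier} (h-homo : RingMorphisms.IsRingHomomorphism 𝑭𝒎 𝑨.rawRing h) where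
    private module h = RingMorphisms.IsRingHomomorphism h-homo

    -- Formulas form a free algebra; this lets an equation checked for all assignments be used under
    -- any homomorphism.
    homomorphism-unique : ∀ t → h t 𝑨.≈ ⟦ t ⟧ (h ∘ var)
    homomorphism-unique (var n) = 𝑨.refl
    homomorphism-unique (s + t) = 𝑨.trans (h.+-homo s t)
      (𝑨.+-cong (homomorphism-unique s) (homomorphism-unique t))
    homomorphism-unique (s · t) = 𝑨.trans (h.*-homo s t)
      (𝑨.*-cong (homomorphism-unique s) (homomorphism-unique t))
    homomorphism-unique (- s)   = 𝑨.trans (h.-‿homo s) (𝑨.-‿cong (homomorphism-unique s))
    homomorphism-unique 0#      = h.0#-homo
    homomorphism-unique 1#      = h.1#-homo

    holds⇒h-equal : ∀ e → Holds e → h (proj₁ e) 𝑨.≈ h (proj₂ e)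
    holds⇒h-equal (s , t) s≈t = begin
      h s              ≈⟨ homomorphism-unique s ⟩
      ⟦ s ⟧ (h ∘ var)  ≈⟨ s≈t (h ∘ var) ⟩
      ⟦ t ⟧ (h ∘ var)  ≈⟨ homomorphism-unique t ⟨
      h t              ∎
      where open SetoidReasoning 𝑨.setoid

-- Soundness

module Soundness (𝑨 : CommutativeRing c r) where
  private module 𝑨 = CommutativeRing 𝑨

  module _ (F : Pred 𝑨.Carrier ℓ) (F-resp : ∀ {a b} → a 𝑨.≈ b → a ∈ F → b ∈ F) where

    -- All homomorphisms are considered at once because an instance by `σ` under `h` is the rule
    -- itself under `h ∘ σ`.
    Preserves : Rule → Set _
    Preserves (Δ ▷ ψ) = ∀ h → RingMorphisms.IsRingHomomorphism 𝑭𝒎 𝑨.rawRing h →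
      All (λ δ → h δ ∈ F) Δ → h ψ ∈ F

    rules-preserve : All Preserves 𝒞ℛ-rules
    rules-preserve = All.concat⁺ (All.map⁺ {f = uncurry _⊣⊢_}
      (All.map (λ {e} → both-preserve e) (axioms-hold 𝑨)))
      where
      both-preserve : ∀ e → Holds 𝑨 e → All Preserves (uncurry _⊣⊢_ e)
      both-preserve e e-holds
        = (λ { h h-homo (p ∷ []) → F-resp (holds⇒h-equal 𝑨 h-homo e e-holds) p })
        ∷ (λ { h h-homo (p ∷ []) → F-resp (𝑨.sym (holds⇒h-equal 𝑨 h-homo e e-holds)) p })
        ∷ []

    module _ {Γ : Pred Fm ℓ} {h : Fm → 𝑨.Carrier}
      (h-homo : RingMorphisms.IsRingHomomorphism 𝑭𝒎 𝑨.rawRing h)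
      (h[Γ]⊆F : ∀ {γ} → γ ∈ Γ → h γ ∈ F) where

      proof-sound : ∀ {p} → IsProof (_∈ˡ 𝒞ℛ-rules) Γ p → All (λ φ → h φ ∈ F) p
      proof-sound []             = []
      proof-sound (by-hyp p φ∈Γ) = h[Γ]⊆F φ∈Γ ∷ proof-sound p
      proof-sound (by-rule p rule σ σ-subst premises) =
        All.lookup rules-preserve rule (h ∘ σ)
          (isRingHomomorphism 𝑨.trans σ-subst h-homo)
          (All.map (All.lookup ih) premises)
        ∷ ih
        where ih = proof-sound p

soundness : {Γ : Pred Fm ℓ} {φ : Fm} → Γ ⊢𝒞ℛ φ → Γ ⊢𝓛[ c , r ] φ
soundness (_ , proof) 𝑨 F F-resp h h-homo h[Γ]⊆F =
  All.head (Soundness.proof-sound 𝑨 F F-resp h-homo h[Γ]⊆F proof)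

-- Substitution as evaluation in the term algebra; equivalence and congruence

open Evaluation 𝑭𝒎 using () renaming (⟦_⟧ to _⟨_⟩)

substitution : ∀ ρ → IsSubstitution (_⟨ ρ ⟩)
substitution ρ = record
  { isSemiringHomomorphism = record
    { isNearSemiringHomomorphism = record
      { +-isMonoidHomomorphism = record
        { isMagmaHomomorphism = record
          { isRelHomomorphism = record { cong = cong _⟨ ρ ⟩ }
          ; homo = λ _ _ → refl
          }
        ; ε-homo = refl
        }
      ; *-homo = λ _ _ → refl
      }
    ; 1#-homo = refl
    }
  ; -‿homo = λ _ → refl
  }

data _⟶_ : Fm → Fm → Set where
  instantiate : ∀ {s t} → (s , t) ∈ˡ axioms → ∀ ρ → (s ⟨ ρ ⟩) ⟶ (t ⟨ ρ ⟩)

infix 3 _∼_ _≋_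

_∼_ : Fm → Fm → Set
_∼_ = EqClosure.EqClosure _⟶_

∼-setoid : Setoid 0ℓ 0ℓ
∼-setoid = EqClosure.setoid _⟶_

module ∼ = Setoid ∼-setoid

_≋_ : Fm → Fm → Set
s ≋ t = ∀ w u → w + u · s ∼ w + u · t

⟪_,_,_,_,_⟫ : (x y z u w : Fm) → ℕ → Fm
⟪ x , y , z , u , w ⟫ 0 = x
⟪ x , y , z , u , w ⟫ 1 = y
⟪ x , y , z , u , w ⟫ 2 = z
⟪ x , y , z , u , w ⟫ 3 = u
-- This covers `var 4` and is also the default for numbers that do not occur in `axioms`.
⟪ x , y , z , u , w ⟫ _ = w

-- For a numeral i, s ⟨ ρ ⟩ and t ⟨ ρ ⟩ compute to formulas without w and u, so this
-- is then a proof of s ⟨ ρ ⟩ ≋ t ⟨ ρ ⟩.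
identity : ∀ (i : Fin (length identities)) x y z w u →
  let (s , t) = lookup identities i ; ρ = ⟪ x , y , z , u , w ⟫ in
  w + u · s ⟨ ρ ⟩ ∼ w + u · t ⟨ ρ ⟩
identity i x y z w u = EqClosure.return
  (instantiate (∈-++⁺ˡ (∈-map⁺ inContext (∈-lookup {xs = identities} i))) ⟪ x , y , z , u , w ⟫)

0+-∼ : ∀ x → 0# + x ∼ x
0+-∼ x = EqClosure.return
  (instantiate (∈-++⁺ʳ (map inContext identities) (here refl)) ⟪ x , x , x , x , x ⟫)

+1·-∼ : ∀ x y → x + 1# · y ∼ x + y
+1·-∼ x y = EqClosure.return
  (instantiate (∈-++⁺ʳ (map inContext identities) (there (here refl))) ⟪ x , y , y , y , y ⟫)

-- The coefficient `u` is taken to be `1#`, which (O) then removes.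
+-∼ : ∀ w {s t} → s ≋ t → w + s ∼ w + t
+-∼ w {s} {t} s≋t = begin
  w + s       ≈⟨ +1·-∼ w s ⟨
  w + 1# · s  ≈⟨ s≋t w 1# ⟩
  w + 1# · t  ≈⟨ +1·-∼ w t ⟩
  w + t       ∎
  where open SetoidReasoning ∼-setoid

≋⇒∼ : ∀ {s t} → s ≋ t → s ∼ t
≋⇒∼ {s} {t} s≋t = begin
  s       ≈⟨ 0+-∼ s ⟨
  0# + s  ≈⟨ +-∼ 0# s≋t ⟩
  0# + t  ≈⟨ 0+-∼ t ⟩
  t       ∎
  where open SetoidReasoning ∼-setoid

≋-setoid : Setoid 0ℓ 0ℓ
≋-setoid = record
  { Carrier = Fm
  ; _≈_ = _≋_
  ; isEquivalence = record
    { refl  = λ _ _ → ∼.refl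
    ; sym   = λ s≋t w u → ∼.sym (s≋t w u)
    ; trans = λ s≋t t≋v w u → ∼.trans (s≋t w u) (t≋v w u)
    }
  }

module ≋ = Setoid ≋-setoid

-- Ring laws and compatibility for congruence

·-assoc : ∀ x y z → (x · y) · z ≋ x · (y · z)
·-assoc x y z = identity 0F x y z

·-comm : ∀ x y → x · y ≋ y · x
-- Here and below, `0#` fills the place of a variable absent from the law.
·-comm x y = identity 1F x y 0#

·-identityʳ : ∀ x → x · 1# ≋ x
·-identityʳ x = identity 2F x 0# 0#

+-assoc : ∀ x y z → (x + y) + z ≋ x + (y + z)
+-assoc x y z = identity 3F x y z

+-comm : ∀ x y → x + y ≋ y + x
+-comm x y = identity 4F x y 0#

+-identityʳ : ∀ x → x + 0# ≋ x
+-identityʳ x = identity 5F x 0# 0#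

+-inverseʳ : ∀ x → x + (- x) ≋ 0#
+-inverseʳ x = identity 6F x 0# 0#

·-distribˡ-+ : ∀ x y z → x · (y + z) ≋ x · y + x · z
·-distribˡ-+ x y z = identity 7F x y z

-‿distribˡ-· : ∀ x y → - (x · y) ≋ (- x) · y
-‿distribˡ-· x y = identity 9F x y 0#

-‿distribʳ-· : ∀ x y → - (x · y) ≋ x · (- y)
-- Index 10, the last entry of `identities`: law (M).
-‿distribʳ-· x y = identity (Fin.suc 9F) x y 0#

-- Compatibility with an operation: a context around the result of the operation is
-- equivalent to another context around its argument s.

+-congʳ : ∀ {s t} v → s ≋ t → s + v ≋ t + v
+-congʳ v s≋t w u = ∼.trans (absorb _) (∼.trans (s≋t _ _) (∼.sym (absorb _)))
  where
  open SetoidReasoning ∼-setoid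
  absorb : ∀ s → w + u · (s + v) ∼ (w + u · v) + u · s
  absorb s = begin
    w + u · (s + v)        ≈⟨ +-∼ w (·-distribˡ-+ u s v) ⟩
    w + (u · s + u · v)    ≈⟨ +-∼ w (+-comm (u · s) (u · v)) ⟩
    -- The rebracketing involves `w` itself, so it happens at the root of the formula.
    w + (u · v + u · s)    ≈⟨ ≋⇒∼ (+-assoc w (u · v) (u · s)) ⟨
    (w + u · v) + u · s    ∎

·-congʳ : ∀ {s t} v → s ≋ t → s · v ≋ t · v
·-congʳ v s≋t w u = ∼.trans (absorb _) (∼.trans (s≋t _ _) (∼.sym (absorb _)))
  where
  open SetoidReasoning ∼-setoid
  absorb : ∀ s → w + u · (s · v) ∼ w + (u · v) · s
  absorb s = begin
    w + u · (s · v)  ≈⟨ ·-comm s v w u ⟩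
    w + u · (v · s)  ≈⟨ +-∼ w (·-assoc u v s) ⟨
    w + (u · v) · s  ∎

-‿cong : ∀ {s t} → s ≋ t → - s ≋ - t
-‿cong s≋t w u = ∼.trans (absorb _) (∼.trans (s≋t _ _) (∼.sym (absorb _)))
  where
  open SetoidReasoning ∼-setoid
  absorb : ∀ s → w + u · (- s) ∼ w + (- u) · s
  absorb s = begin
    -- (M) backwards takes the sign out of the product, and (L) moves it onto the coefficient.
    w + u · (- s)    ≈⟨ +-∼ w (-‿distribʳ-· u s) ⟨
    w + (- (u · s))  ≈⟨ +-∼ w (-‿distribˡ-· u s) ⟩
    w + (- u) · s    ∎

-- Commutativity carries compatibility in the left argument over to the right one.
+-cong : ∀ {s s′ t t′} → s ≋ s′ → t ≋ t′ → s + t ≋ s′ + t′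
+-cong {s} {s′} {t} {t′} s≋s′ t≋t′ = begin
  s + t    ≈⟨ +-congʳ t s≋s′ ⟩
  s′ + t   ≈⟨ +-comm s′ t ⟩
  t + s′   ≈⟨ +-congʳ s′ t≋t′ ⟩
  t′ + s′  ≈⟨ +-comm t′ s′ ⟩
  s′ + t′  ∎
  where open SetoidReasoning ≋-setoid

·-cong : ∀ {s s′ t t′} → s ≋ s′ → t ≋ t′ → s · t ≋ s′ · t′
·-cong {s} {s′} {t} {t′} s≋s′ t≋t′ = begin
  s · t    ≈⟨ ·-congʳ t s≋s′ ⟩
  s′ · t   ≈⟨ ·-comm s′ t ⟩
  t · s′   ≈⟨ ·-congʳ s′ t≋t′ ⟩
  t′ · s′  ≈⟨ ·-comm t′ s′ ⟩
  s′ · t′  ∎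
  where open SetoidReasoning ≋-setoid

-- The ring of formulas modulo congruence

Fm-isCommutativeRing : IsCommutativeRing _≋_ _+_ _·_ -_ 0# 1#
Fm-isCommutativeRing = record
  { isRing = record
    { +-isAbelianGroup = record
      { isGroup = record
        { isMonoid = record
          { isSemigroup = record
            { isMagma = record
              { isEquivalence = ≋.isEquivalence
              ; ∙-cong = +-cong
              }
            ; assoc = +-assoc
            }
          ; identity = comm∧idʳ⇒id ≋-setoid +-comm +-identityʳ
          }
        ; inverse = comm∧invʳ⇒inv ≋-setoid +-comm +-inverseʳ
        ; ⁻¹-cong = -‿cong
        }
      ; comm = +-comm
      }
    ; *-cong     = ·-cong
    ; *-assoc    = ·-assoc
    ; *-identity = comm∧idʳ⇒id ≋-setoid ·-comm ·-identityʳ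
    ; distrib    = comm∧distrˡ⇒distr ≋-setoid +-cong ·-comm ·-distribˡ-+
    }
  ; *-comm = ·-comm
  }

-- The consequence relation ranges over rings at levels `c` and `r`, so formulas are lifted there;
-- the ring laws pull back along the injective homomorphism `lower`.
Fm-commutativeRing : ∀ c r → CommutativeRing c r
Fm-commutativeRing c r = record
  { isCommutativeRing = RingMonomorphism.isCommutativeRing lower-isRingMonomorphism
      Fm-isCommutativeRing
  }
  where
  Fm/≋ Fm/≋↑ : RawRing _ _
  Fm/≋ = record
    { _≈_ = _≋_ ; _+_ = _+_ ; _*_ = _·_ ; -_ = -_ ; 0# = 0# ; 1# = 1# }
  Fm/≋↑ = record
    { Carrier = Lift c Fm
    ; _≈_     = λ { (lift s) (lift t) → Lift r (s ≋ t) }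
    ; _+_     = λ { (lift s) (lift t) → lift (s + t) }
    ; _*_     = λ { (lift s) (lift t) → lift (s · t) }
    ; -_      = λ { (lift s) → lift (- s) }
    ; 0#      = lift 0#
    ; 1#      = lift 1#
    }

  lower-isRingMonomorphism : RingMorphisms.IsRingMonomorphism Fm/≋↑ Fm/≋ lower
  lower-isRingMonomorphism = record
    { isRingHomomorphism = record
      { isSemiringHomomorphism = record
        { isNearSemiringHomomorphism = record
          { +-isMonoidHomomorphism = record
            { isMagmaHomomorphism = record
              { isRelHomomorphism = record { cong = lower }
              ; homo = λ _ _ → ≋.refl
              }
            ; ε-homo = ≋.refl
            }
          ; *-homo = λ _ _ → ≋.refl
          }
        ; 1#-homo = ≋.refl
        }
      ; -‿homo = λ _ → ≋.refl
      }
    ; injective = lift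
    }

-- This is the quotient map: the formula stays the same, while its equality is coarsened from
-- syntactic to congruence.
lift-isRingHomomorphism : ∀ {c r} →
  RingMorphisms.IsRingHomomorphism 𝑭𝒎 (CommutativeRing.rawRing (Fm-commutativeRing c r)) lift
lift-isRingHomomorphism = record
  { isSemiringHomomorphism = record
    { isNearSemiringHomomorphism = record
      { +-isMonoidHomomorphism = record
        { isMagmaHomomorphism = record
          { isRelHomomorphism = record { cong = λ { refl → lift ≋.refl } }
          ; homo = λ _ _ → lift ≋.refl
          }
        ; ε-homo = lift ≋.refl
        }
      ; *-homo = λ _ _ → lift ≋.refl
      }
    ; 1#-homo = lift ≋.refl
    }
  ; -‿homo = λ _ → lift ≋.refl
  }

-- Completeness

module _ {Γ : Pred Fm ℓ} where

  ⊢-apply : ∀ {s t} → ([ s ] ▷ t) ∈ˡ 𝒞ℛ-rules → ∀ ρ → Γ ⊢𝒞ℛ s ⟨ ρ ⟩ → Γ ⊢𝒞ℛ t ⟨ ρ ⟩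
  ⊢-apply rule ρ (_ , proof) =
    _ , by-rule proof rule (_⟨ ρ ⟩) (substitution ρ) (here refl ∷ [])

  ⟶⇒⊢⇔ : ∀ {s t} → s ⟶ t → (Γ ⊢𝒞ℛ s) ⇔ (Γ ⊢𝒞ℛ t)
  ⟶⇒⊢⇔ (instantiate e∈axioms ρ) = mk⇔
    -- Of the two rules that an axiom yields, the first goes left to right and the second is its
    -- converse.
    (⊢-apply (∈-concatMap⁺ (uncurry _⊣⊢_) (Any.map (λ { refl → here refl }) e∈axioms)) ρ)
    (⊢-apply (∈-concatMap⁺ (uncurry _⊣⊢_) (Any.map (λ { refl → there (here refl) }) e∈axioms)) ρ)

  -- Having equivalent derivability from `Γ` is an equivalence relation containing `_⟶_`, hence
  -- contains the one generated by it.
  ∼⇒⊢⇔ : ∀ {s t} → s ∼ t → (Γ ⊢𝒞ℛ s) ⇔ (Γ ⊢𝒞ℛ t)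
  ∼⇒⊢⇔ = EqClosure.fold (On.isEquivalence (Γ ⊢𝒞ℛ_) ⇔-isEquivalence) ⟶⇒⊢⇔

  completeness : ∀ {φ} → Γ ⊢𝓛[ c , r ] φ → Γ ⊢𝒞ℛ φ
  completeness {c = c} {r = r} Γ⊢φ =
    Γ⊢φ (Fm-commutativeRing c r) (λ s → Γ ⊢𝒞ℛ lower s)
      -- The chosen subset respects congruence because derivability passes between congruent
      -- formulas; it contains `Γ` by one-line proofs.
      (λ s≋t → Equivalence.to (∼⇒⊢⇔ (≋⇒∼ (lower s≋t))))
      lift lift-isRingHomomorphism (λ γ∈Γ → _ , by-hyp [] γ∈Γ)

theorem4p6 : ∀ (c r ℓ : Level) (Γ : Pred Fm ℓ) (φ : Fm) →
    (Γ ⊢𝒞ℛ φ) ⇔ (Γ ⊢𝓛[ c , r ] φ)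
theorem4p6 c r ℓ Γ φ = mk⇔ soundness completeness
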